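{- Let $T$ be a complete first-order theory. If $T$ is weakly VC-minimal, then either $T$ is stable or $T$ interprets an infinite linear order.
   Context: $\mathfrak{C}$ denotes a monster model of $T$. "Formula" means a $\emptyset$-definable formula in the language of $T$ unless otherwise specified; $x$ denotes a single variable, $\overline{y}, \overline{z}$ finite tuples of variables, $\mathrm{lg}(\overline{y})$ the length of $\overline{y}$. For a tuple $\overline{c}$ from $\mathfrak{C}$, $\psi(\mathfrak{C};\overline{c}) = \{a \in \mathfrak{C} : \models \psi(a;\overline{c})\}$. Independence dimension of a formula: a formula $\psi(x;\overline{z})$ has independence dimension $\le 1$ if the family $\{\psi(\mathfrak{C};\overline{c}) : \overline{c} \in \mathfrak{C}^{\mathrm{lg}(\overline{z})}\}$ of subsets of $\mathfrak{C}$ contains no two distinct members $B_0, B_1$ that are independent, i.e. for which all four sets $B_0^{s} \cap B_1^{t}$ ($s,t \in \{0,1\}$) are nonempty, where $B^1 = B$ and $B^0 = \mathfrak{C} \setminus B$. Weakly VC-minimal: $T$ is weakly VC-minimal if for all formulas $\varphi(x;\overline{y})$ and all $\overline{b} \in \mathfrak{C}^{\mathrm{lg}(\overline{y})}$ there exist formulas $\psi_0(x;\overline{z}_0), \dots, \psi_{n-1}(x;\overline{z}_{n-1})$, each of independence dimension $\le 1$, and tuples $\overline{c}_0,\dots,\overline{c}_{n-1}$ from $\mathfrak{C}$ of the appropriate lengths such that $\varphi(x;\overline{b})$ is a boolean combination of the $\psi_i(x;\overline{c}_i)$ (up to equivalence in $\mathfrak{C}$). "Stable" and "interprets" have their usual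 model-theoretic meanings. -}

module Defs where

open import Data.Bool.Base using (Bool; true; false)
open import Data.Empty.Polymorphic using (⊥)
open import Data.Fin.Base using (Fin)
open import Data.List.Base using (List)
import Data.List.Relation.Unary.All as List
open import Data.Nat.Base using (ℕ; zero; suc; _+_; _<_)
open import Data.Product.Base using (Σ; Σ-syntax; ∃-syntax; _×_; _,_; proj₁)
open import Data.Sum.Base using (_⊎_)
open import Data.Vec.Base using (Vec; []; _∷_; _++_; lookup; map)
open import Function.Base using (_on_)
open import Function.Bundles using (_⇔_; _↔_; Inverse)
open import Function.Definitions using (Injective)
open import Level using (Level; _⊔_) renaming (suc to lsuc)
open import Relation.Binary.Core using (Rel)
open import Relation.Binary.PropositionalEquality.Core using (_≡_)
open import Relation.Binary.Structures using (IsTotalOrder)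
open import Relation.Nullary.Negation.Core using (¬_)
open import Relation.Unary using (Pred; _≐_; _∩_; _∪_; ∁; Satisfiable)
open import Relation.Unary.Polymorphic using (∅)

private
  variable
    ℓ c : Level

------------------------------------------------------------------------
-- First-order logic with equality

record Language (ℓ : Level) : Set (lsuc ℓ) where
  field
    FunSym : ℕ → Set ℓ
    RelSym : ℕ → Set ℓ

open Language public

data Term (L : Language ℓ) (n : ℕ) : Set ℓ where
  var : Fin n → Term L n
  app : ∀ {k} → FunSym L k → Vec (Term L n) k → Term L n

-- Variables are de Bruijn indices: in `All φ` and `Ex φ` the bound
-- variable is variable 0 of φ.
data Formula (L : Language ℓ) (n : ℕ) : Set ℓ where
  Bot         : Formula L n
  Eq          : Term L n → Term L n → Formula L n
  Atom        : ∀ {k} → RelSym L k → Vec (Term L n) k → Formula L n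
  And Or Imp  : Formula L n → Formula L n → Formula L n
  All Ex      : Formula L (suc n) → Formula L n

Neg : {L : Language ℓ} {n : ℕ} → Formula L n → Formula L n
Neg φ = Imp φ Bot

Sentence : Language ℓ → Set ℓ
Sentence L = Formula L 0

Theory : Language ℓ → Set (lsuc ℓ)
Theory {ℓ} L = Pred (Sentence L) ℓ

-- As usual in model theory, structures are nonempty.
record Structure (L : Language ℓ) (c : Level) : Set (ℓ ⊔ lsuc c) where
  field
    Carrier  : Set c
    nonempty : Carrier
    fun      : ∀ {k} → FunSym L k → Vec Carrier k → Carrier
    rel      : ∀ {k} → RelSym L k → Vec Carrier k → Set c

module _ {L : Language ℓ} (M : Structure L c) where
  open Structure M

  mutual
    eval : ∀ {n} → Term L n → Vec Carrier n → Carrier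
    eval (var i)    v = lookup v i
    eval (app f ts) v = fun f (evals ts v)

    evals : ∀ {n k} → Vec (Term L n) k → Vec Carrier n → Vec Carrier k
    evals []       v = []
    evals (t ∷ ts) v = eval t v ∷ evals ts v

  infix 4 _⊨_[_]
  _⊨_[_] : ∀ {n} → Formula L n → Vec Carrier n → Set c
  _⊨_[_] Bot         v = ⊥
  _⊨_[_] (Eq s t)    v = eval s v ≡ eval t v
  _⊨_[_] (Atom R ts) v = rel R (evals ts v)
  _⊨_[_] (And φ ψ)   v = _⊨_[_] φ v × _⊨_[_] ψ v
  _⊨_[_] (Or φ ψ)    v = _⊨_[_] φ v ⊎ _⊨_[_] ψ v
  _⊨_[_] (Imp φ ψ)   v = _⊨_[_] φ v → _⊨_[_] ψ v
  _⊨_[_] (All φ)     v = (a : Carrier) → _⊨_[_] φ (a ∷ v)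
  _⊨_[_] (Ex φ)      v = Σ[ a ∈ Carrier ] _⊨_[_] φ (a ∷ v)

  IsModel : Theory L → Set (ℓ ⊔ c)
  IsModel T = ∀ σ → T σ → _⊨_[_] σ []

-- Models in the universe of the language suffice for semantic
-- consequence, by the (downward) Löwenheim–Skolem theorem.
Entails : {L : Language ℓ} → Theory L → Sentence L → Set (lsuc ℓ)
Entails {ℓ} {L} T σ = (M : Structure L ℓ) → IsModel M T → M ⊨ σ [ [] ]

record Complete {L : Language ℓ} (T : Theory L) : Set (lsuc ℓ) where
  field
    satisfiable : Σ[ M ∈ Structure L ℓ ] IsModel M T
    decides     : ∀ σ → Entails T σ ⊎ Entails T (Neg σ)

------------------------------------------------------------------------
-- Monster models

record Automorphism {L : Language ℓ} (M : Structure L c) : Set (ℓ ⊔ c) where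
  open Structure M
  field
    bijection : Carrier ↔ Carrier

  open Inverse bijection public using (to)

  field
    fun-homo : ∀ {k} (f : FunSym L k) v → to (fun f v) ≡ fun f (map to v)
    rel-homo : ∀ {k} (R : RelSym L k) v → rel R v ⇔ rel R (map to v)

-- "Small" means: indexed by a type in the universe `Set ℓ` of the
-- language.  A monster model is saturated and strongly homogeneous with
-- respect to all small sets of parameters; an infinite one has its carrier
-- in a universe above ℓ.
module _ {L : Language ℓ} (M : Structure L c) where
  open Structure M

  -- A formula φ(x; ā) in the variable x with parameters ā from A.
  ParamFormula : Set ℓ → Set ℓ
  ParamFormula A = Σ[ n ∈ ℕ ] Formula L (suc n) × Vec A n

  Realizes : {A : Set ℓ} → (A → Carrier) → Carrier → ParamFormula A → Set c
  Realizes f x (_ , φ , as) = M ⊨ φ [ x ∷ map f as ]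

  FinitelySatisfiable : {A : Set ℓ} → (A → Carrier) → Pred (ParamFormula A) ℓ →
                        Set (ℓ ⊔ c)
  FinitelySatisfiable f p =
    ∀ θs → List.All p θs → ∃[ x ] List.All (Realizes f x) θs

  Saturated : Set (lsuc ℓ ⊔ c)
  Saturated = (A : Set ℓ) (f : A → Carrier) (p : Pred (ParamFormula A) ℓ) →
              FinitelySatisfiable f p →
              ∃[ x ] (∀ θ → p θ → Realizes f x θ)

  StronglyHomogeneous : Set (lsuc ℓ ⊔ c)
  StronglyHomogeneous =
    (A : Set ℓ) (f g : A → Carrier) →
    (∀ {n} (φ : Formula L n) (as : Vec A n) →
       M ⊨ φ [ map f as ] ⇔ M ⊨ φ [ map g as ]) →
    Σ[ α ∈ Automorphism M ] (∀ a → Automorphism.to α (f a) ≡ g a)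

record IsMonsterModel {L : Language ℓ} (T : Theory L) (M : Structure L c) :
                      Set (lsuc ℓ ⊔ c) where
  field
    isModel             : IsModel M T
    saturated           : Saturated M
    stronglyHomogeneous : StronglyHomogeneous M

------------------------------------------------------------------------
-- Boolean combinations of n sets

data BoolExpr (n : ℕ) : Set where
  gen       : Fin n → BoolExpr n
  empty     : BoolExpr n
  compl     : BoolExpr n → BoolExpr n
  meet join : BoolExpr n → BoolExpr n → BoolExpr n

combine : ∀ {a} {A : Set a} {n} → BoolExpr n → (Fin n → Pred A c) → Pred A c
combine (gen i)    B = B i
combine empty      B = ∅
combine (compl e)  B = ∁ (combine e B)
combine (meet e f) B = combine e B ∩ combine f B
combine (join e f) B = combine e B ∪ combine f B

-- B ^ 1 = B and B ^ 0 = complement of B, with true, false for 1, 0.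
infix 8 _^_
_^_ : ∀ {a} {A : Set a} → Pred A c → Bool → Pred A c
B ^ true  = B
B ^ false = ∁ B

Independent : ∀ {a} {A : Set a} → Pred A c → Pred A c → Set (a ⊔ c)
Independent B₀ B₁ = ∀ s t → Satisfiable ((B₀ ^ s) ∩ (B₁ ^ t))

------------------------------------------------------------------------
-- Properties of a complete theory, read off from its monster model M

module _ {L : Language ℓ} (M : Structure L c) where
  open Structure M

  -- In ψ(x; z̄) with lg(z̄) = k, the variable x is variable 0.
  instanceSet : ∀ {k} → Formula L (suc k) → Vec Carrier k → Pred Carrier c
  instanceSet ψ cs = λ x → M ⊨ ψ [ x ∷ cs ]

  IndependenceDimension≤1 : ∀ {k} → Formula L (suc k) → Set c
  IndependenceDimension≤1 ψ =
    ∀ cs ds → ¬ (instanceSet ψ cs ≐ instanceSet ψ ds) →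
    ¬ Independent (instanceSet ψ cs) (instanceSet ψ ds)

  WeaklyVCMinimal : Set (ℓ ⊔ c)
  WeaklyVCMinimal =
    ∀ {m} (φ : Formula L (suc m)) (bs : Vec Carrier m) →
    Σ[ n ∈ ℕ ]
    Σ[ k ∈ (Fin n → ℕ) ]
    Σ[ ψ ∈ ((i : Fin n) → Formula L (suc (k i))) ]
    Σ[ cs ∈ ((i : Fin n) → Vec Carrier (k i)) ]
      (∀ i → IndependenceDimension≤1 (ψ i)) ×
      (Σ[ e ∈ BoolExpr n ]
         instanceSet φ bs ≐ combine e (λ i → instanceSet (ψ i) (cs i)))

  OrderProperty : (m n : ℕ) → Formula L (m + n) → Set c
  OrderProperty m n φ =
    Σ[ a ∈ (ℕ → Vec Carrier m) ]
    Σ[ b ∈ (ℕ → Vec Carrier n) ]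
      (∀ i j → M ⊨ φ [ a i ++ b j ] ⇔ i < j)

  Stable : Set (ℓ ⊔ c)
  Stable = ∀ m n (φ : Formula L (m + n)) → ¬ OrderProperty m n φ

  definableSet : ∀ {d p} → Formula L (d + p) → Vec Carrier p →
                 Pred (Vec Carrier d) c
  definableSet δ ws x = M ⊨ δ [ x ++ ws ]

  definableRel : ∀ {d p} → Formula L (d + (d + p)) → Vec Carrier p →
                 Rel (Vec Carrier d) c
  definableRel θ ws x y = M ⊨ θ [ x ++ (y ++ ws) ]

  -- An infinite linear order on D/E, where D ⊆ Mᵈ, the equivalence
  -- relation E on D and the (reflexive) order on D/E are definable with
  -- parameters.  `IsTotalOrder` over E says exactly that the relation is
  -- E-invariant and induces a linear order on D/E.
  record InterpretsInfiniteLinearOrder : Set (ℓ ⊔ c) where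
    field
      {d p}  : ℕ
      params : Vec Carrier p
      domF   : Formula L (d + p)
      eqF    : Formula L (d + (d + p))
      leF    : Formula L (d + (d + p))

    Domain : Set c
    Domain = Σ (Vec Carrier d) (definableSet domF params)

    _≈_ : Rel Domain c
    _≈_ = definableRel eqF params on proj₁

    _≤_ : Rel Domain c
    _≤_ = definableRel leF params on proj₁

    field
      isTotalOrder : IsTotalOrder _≈_ _≤_
      enum         : ℕ → Domain
      infinite     : Injective _≡_ _≈_ enum

{-# OPTIONS --safe #-}
-- Suppose no infinite linear order is interpretable.  Call a relation
-- R(x; y) of infinite rank if for every h the y-instances split the whole
-- space in a complete binary tree of height h.
--
-- If ψ(x; z) has independence dimension ≤ 1 and infinite rank, saturation
-- gives an infinite such tree.  At each node one of the two sides of the next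
-- instance lies inside the half just chosen; always turning towards that side
-- produces a strictly decreasing chain of sides, all containing some a₀ and
-- all omitting some a₁.  The sides that contain a₀ and omit a₁ are linearly
-- ordered by inclusion, and this order is definable over a₀, a₁.  So every
-- such ψ has finite rank.
--
-- Finite rank makes types over a set definable by cells of minimal rank, so
-- only countably many are realised over a countable set, whereas diagonalising
-- along a branch of an infinite tree gives uncountably many.  By saturation
-- finitely many Boolean shapes express all instances of a formula φ(x; y) in a
-- single variable x by formulas of dimension ≤ 1; hence its types are
-- countable in number too and φ has finite rank.  Since the definition of the
-- type of x over (x̄, parameters) is again a formula about x̄, induction on the
-- number of variables bounds the types of all formulas, which excludes the
-- order property because a ladder has infinite rank.
module Submission where

open import Defs
open import Axiom.ExcludedMiddle using (ExcludedMiddle)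
open import Data.Bool.Base using (Bool; true; false; not)
open import Data.Empty using (⊥; ⊥-elim)
open import Data.Fin.Base using (Fin; zero; suc; _↑ˡ_; _↑ʳ_; splitAt)
  renaming (lift to liftFin)
open import Data.List.Base using (List; []; _∷_; concat)
open import Data.List.Relation.Unary.All as ListAll using ([]; _∷_)
open import Data.List.Relation.Unary.All.Properties using (concat⁻; ¬All⇒Any¬)
open import Data.List.Relation.Unary.Any as Any using (Any; here; there)
open import Data.Nat.Base using (ℕ; zero; suc; _+_; _<_; _≤_)
open import Data.Nat.Properties
  using (+-comm; +-assoc; +-suc; ≤-trans; ≤-refl; m≤m+n; <⇒≱; <-cmp; m≤n⇒∃[o]m+o≡n)
open import Data.Product.Base using (Σ; Σ-syntax; ∃; ∃-syntax; _×_; _,_; proj₁; proj₂; uncurry)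
open import Data.Product.Function.NonDependent.Propositional using (_×-⇔_)
open import Data.Sum.Base as Sum using (_⊎_; inj₁; inj₂; [_,_]′)
open import Data.Sum.Function.Propositional using (_⊎-⇔_)
open import Data.Unit.Polymorphic.Base using (⊤; tt)
open import Data.Vec.Base using (Vec; []; _∷_; _++_; lookup; map; tabulate; replicate; head; tail)
open import Data.Vec.Properties
  using (lookup-++ˡ; lookup-++ʳ; lookup-splitAt; lookup∘tabulate; tabulate∘lookup;
         tabulate-∘; tabulate-cong)
open import Function.Base using (_∘_; id)
open import Function.Bundles using (_⇔_; mk⇔; Equivalence)
open import Function.Construct.Composition using (_⇔-∘_)
open import Function.Construct.Identity using (⇔-id)
open import Function.Construct.Symmetry using (⇔-sym)
open import Function.Related.TypeIsomorphisms using (→-cong-⇔; ¬-cong-⇔)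
open import Level using (Level; _⊔_; Lift; lift; lower; 0ℓ) renaming (suc to lsuc)
open import Relation.Binary.Definitions using (tri<; tri≈; tri>)
open import Relation.Binary.PropositionalEquality using (_≡_; refl; sym; trans; cong; cong₂; subst)
open import Relation.Nullary.Decidable.Core using (Dec; yes; no; does; decidable-stable)
open import Relation.Nullary.Negation.Core using (¬_)
open import Relation.Unary using (Pred; _∩_; _⊆_; _≐_; Satisfiable)

open Equivalence using (to; from)

private
  variable
    ℓ c e e′ p q : Level
    m n : ℕ

-- Congruence of logical equivalence and classical quantifiers

∃-cong-⇔ : {A : Set e} {P : A → Set p} {Q : A → Set q} →
           (∀ x → P x ⇔ Q x) → ∃ P ⇔ ∃ Q
∃-cong-⇔ P⇔Q = mk⇔ (λ (x , Px) → x , to (P⇔Q x) Px)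
                    (λ (x , Qx) → x , from (P⇔Q x) Qx)

∀-cong-⇔ : {A : Set e} {P : A → Set p} {Q : A → Set q} →
           (∀ x → P x ⇔ Q x) → (∀ x → P x) ⇔ (∀ x → Q x)
∀-cong-⇔ P⇔Q = mk⇔ (λ f x → to (P⇔Q x) (f x)) (λ f x → from (P⇔Q x) (f x))

≡⇒⇔ : {A B : Set p} → A ≡ B → A ⇔ B
≡⇒⇔ refl = ⇔-id _

¬∀⇒∃¬ : (∀ a → ExcludedMiddle a) → {A : Set e} {P : A → Set p} →
        ¬ (∀ x → P x) → ∃[ x ] ¬ P x
¬∀⇒∃¬ em {A} {P} ¬∀ = decidable-stable (em _) λ none →
  ¬∀ λ x → decidable-stable (em _) λ ¬Px → none (x , ¬Px)

-- Rank

module _ {X Y : Set c} (R : X → Y → Set c) where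

  cut : Y → Bool → Pred X c
  cut y b = (λ x → R x y) ^ b

  -- This is Shelah's local 2-rank, or the Littlestone dimension, of `P`: the label `y` may be
  -- chosen anew at every node of the tree.
  Rank≥ : ℕ → Pred X c → Set c
  Rank≥ zero    P = Satisfiable P
  Rank≥ (suc h) P = ∃[ y ] ∀ b → Rank≥ h (P ∩ cut y b)

  Rank≥-mono : ∀ h {P Q : Pred X c} → P ⊆ Q → Rank≥ h P → Rank≥ h Q
  Rank≥-mono zero    P⊆Q (x , Px)   = x , P⊆Q Px
  Rank≥-mono (suc h) P⊆Q (y , split) =
    y , λ b → Rank≥-mono h (λ (Px , s) → P⊆Q Px , s) (split b)

  Rank≥-pred : ∀ h {P : Pred X c} → Rank≥ (suc h) P → Rank≥ h P
  Rank≥-pred h (y , split) = Rank≥-mono h proj₁ (split true)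

  ladderLength : ℕ → ℕ
  ladderLength zero    = 1
  ladderLength (suc h) = ladderLength h + ladderLength h

  -- A block of `2 ^ h` consecutive `a i` is halved by the `b` at its midpoint, and both halves are
  -- again such blocks.
  ladder⇒Rank≥ : (a : ℕ → X) (b : ℕ → Y) → (∀ i j → R (a i) (b j) ⇔ i < j) →
                 ∀ h k {P : Pred X c} →
                 (∀ i → k ≤ i → i < k + ladderLength h → P (a i)) → Rank≥ h P
  ladder⇒Rank≥ a b R⇔< zero    k Pa = a k , Pa k ≤-refl (subst (k <_) (+-comm 1 k) ≤-refl)
  ladder⇒Rank≥ a b R⇔< (suc h) k Pa = b (k + l) , λ where
      true  → ladder⇒Rank≥ a b R⇔< h k λ i k≤i i<k+l →
        Pa i k≤i (≤-trans i<k+l (subst (k + l ≤_) (+-assoc k l l) (m≤m+n (k + l) l))) ,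
        from (R⇔< i (k + l)) i<k+l
      false → ladder⇒Rank≥ a b R⇔< h (k + l) λ i k+l≤i i<k+l+l →
        Pa i (≤-trans (m≤m+n k l) k+l≤i) (subst (i <_) (+-assoc k l l) i<k+l+l) ,
        λ Rab → <⇒≱ (to (R⇔< i (k + l)) Rab) k+l≤i
    where l = ladderLength h

-- Countable families of types

Enumerable : Set e → Set e
Enumerable A = Σ[ enum ∈ (ℕ → A) ] ∀ a → ∃[ k ] enum k ≡ a

-- Cantor's walk: an antidiagonal is run from `(s , 0)` to `(0 , s)`, and then the next one is
-- entered.
diagonalSuc : ℕ × ℕ → ℕ × ℕ
diagonalSuc (zero  , b) = suc b , zero
diagonalSuc (suc a , b) = a , suc b

unpair : ℕ → ℕ × ℕ
unpair zero    = zero , zero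
unpair (suc k) = diagonalSuc (unpair k)

-- The pair `(a , b)` lies `b` steps after the start `(b + a , 0)` of its antidiagonal, and each
-- later start follows the end of the previous antidiagonal.
unpair-surjective : ∀ ab → ∃[ k ] unpair k ≡ ab
unpair-surjective (a , b) = diagonal b a (axis (b + a))
  where
  Reached : ℕ × ℕ → Set
  Reached ab = ∃[ k ] unpair k ≡ ab

  step : ∀ {ab} → Reached ab → Reached (diagonalSuc ab)
  step (k , eq) = suc k , cong diagonalSuc eq

  diagonal : ∀ b a → Reached (b + a , zero) → Reached (a , b)
  diagonal zero    a r = r
  diagonal (suc b) a r =
    step (diagonal b (suc a) (subst (λ s → Reached (s , zero)) (sym (+-suc b a)) r))

  axis : ∀ s → Reached (s , zero)
  axis zero    = zero , refl
  axis (suc s) =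
    step (diagonal s zero (subst (λ t → Reached (t , zero)) (+-comm zero s) (axis s)))

ℕ-enumerable : Enumerable ℕ
ℕ-enumerable = id , λ k → k , refl

Bool-enumerable : Enumerable Bool
Bool-enumerable = (λ { zero → false ; (suc _) → true }) ,
                  λ { false → 0 , refl ; true → 1 , refl }

Σ-enumerable : {A : Set e} {B : A → Set q} →
               Enumerable A → (∀ a → Enumerable (B a)) → Enumerable (Σ A B)
Σ-enumerable {A = A} {B} (eA , sA) eB = enum , surj
  where
  pick : ℕ × ℕ → Σ A B
  pick (i , j) = eA i , proj₁ (eB (eA i)) j

  enum : ℕ → Σ A B
  enum = pick ∘ unpair

  surj : ∀ ab → ∃[ k ] enum k ≡ ab
  surj (a , b) with sA a
  ... | i , refl with proj₂ (eB (eA i)) b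
  ... | j , refl = let k , eq = unpair-surjective (i , j) in k , cong pick eq

List-enumerable : {A : Set e} → Enumerable A → Enumerable (List A)
List-enumerable {A = A} (eA , sA) = uncurry enum ∘ unpair , λ as →
  let l , k , eq = surj as
      j , eq′    = unpair-surjective (l , k)
  in j , trans (cong (uncurry enum) eq′) eq
  where
  -- Fixing the length first makes the decoding structurally recursive.
  enum : ℕ → ℕ → List A
  enum zero    _ = []
  enum (suc l) k = eA (proj₁ (unpair k)) ∷ enum l (proj₂ (unpair k))

  surj : ∀ as → ∃[ l ] ∃[ k ] enum l k ≡ as
  surj []       = zero , zero , refl
  surj (a ∷ as) =
    let i , eq      = sA a
        l , k , eqs = surj as
        j , eq′     = unpair-surjective (i , k)
    in suc l , j , cong₂ _∷_ (trans (cong (eA ∘ proj₁) eq′) eq)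
                             (trans (cong (enum l ∘ proj₂) eq′) eqs)

-- The type of `x` is the part of `J` cut out by `R x`. The list `S` may contain repetitions and
-- unrealised types, so only an upper bound is asserted.
CountablyManyTypes : {X : Set e} {J : Set q} → (X → J → Set c) → Set (e ⊔ q ⊔ lsuc c)
CountablyManyTypes {c = c} {J = J} R =
  Σ[ S ∈ (ℕ → J → Set c) ] ∀ x → ∃[ k ] ∀ j → R x j ⇔ S k j

module _ {X : Set e} {J : Set q} where

  types-indexed-by : {K : Set p} → Enumerable K → {R : X → J → Set c} (S : K → J → Set c) →
                     (∀ x → ∃[ k ] ∀ j → R x j ⇔ S k j) → CountablyManyTypes R
  types-indexed-by (enum , surj) {R} S type = S ∘ enum , λ x →
    let k , R⇔S = type x
        i , eq  = surj k
    in i , subst (λ k → ∀ j → R x j ⇔ S k j) (sym eq) R⇔S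

  types-const : {S : J → Set c} → CountablyManyTypes {X = X} (λ _ → S)
  types-const {S = S} = (λ _ → S) , λ _ → zero , λ _ → ⇔-id _

  types-not : {R : X → J → Set c} → CountablyManyTypes R →
              CountablyManyTypes (λ x j → ¬ R x j)
  types-not (S , type) = (λ k j → ¬ S k j) , λ x →
    let k , R⇔S = type x in k , λ j → ¬-cong-⇔ (R⇔S j)

  module _ {R R′ : X → J → Set c} where
    types-and : CountablyManyTypes R → CountablyManyTypes R′ →
                CountablyManyTypes (λ x j → R x j × R′ x j)
    types-and (S , type) (S′ , type′) =
      types-indexed-by (Σ-enumerable ℕ-enumerable λ _ → ℕ-enumerable)
        (λ (k , k′) j → S k j × S′ k′ j) λ x →
        let k , R⇔S = type x
            k′ , R⇔S′ = type′ x
        in (k , k′) , λ j → R⇔S j ×-⇔ R⇔S′ j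

    types-or : CountablyManyTypes R → CountablyManyTypes R′ →
               CountablyManyTypes (λ x j → R x j ⊎ R′ x j)
    types-or (S , type) (S′ , type′) =
      types-indexed-by (Σ-enumerable ℕ-enumerable λ _ → ℕ-enumerable)
        (λ (k , k′) j → S k j ⊎ S′ k′ j) λ x →
        let k , R⇔S = type x
            k′ , R⇔S′ = type′ x
        in (k , k′) , λ j → R⇔S j ⊎-⇔ R⇔S′ j

  types-combine : (ε : BoolExpr n) {B : J → Fin n → Pred X c} →
                  (∀ i → CountablyManyTypes (λ x j → B j i x)) →
                  CountablyManyTypes (λ x j → combine ε (B j) x)
  types-combine (gen i)    ts = ts i
  types-combine empty      ts = types-const
  types-combine (compl ε)  ts = types-not (types-combine ε ts)
  types-combine (meet ε η) ts = types-and (types-combine ε ts) (types-combine η ts)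
  types-combine (join ε η) ts = types-or (types-combine ε ts) (types-combine η ts)

-- The diagonal step: a point on the side opposite to the truth value of `Q` refutes `Q` as a
-- prediction.
wrong-side : {A : Set p} {B : Pred A c} {x : A} {Q : Set c} (d : Dec Q) →
             (B ^ not (does d)) x → ¬ (B x ⇔ Q)
wrong-side (yes Qx) ¬Bx B⇔Q = ¬Bx (from B⇔Q Qx)
wrong-side (no ¬Qx) Bx  B⇔Q = ¬Qx (to B⇔Q Bx)

types-pull : {X : Set e} {X′ : Set e′} {J : Set q} {R : X → J → Set c} {R′ : X′ → J → Set c}
             (f : X′ → X) → (∀ x j → R′ x j ⇔ R (f x) j) →
             CountablyManyTypes R → CountablyManyTypes R′
types-pull f R′⇔R (S , type) = S , λ x →
  let k , R⇔S = type (f x) in k , λ j → R⇔S j ⇔-∘ R′⇔R x j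

-- Flattening of families of tuples

totalLength : (Fin n → ℕ) → ℕ
totalLength {zero}  k = 0
totalLength {suc n} k = k zero + totalLength (k ∘ suc)

blockIndex : {k : Fin n → ℕ} (i : Fin n) → Fin (k i) → Fin (totalLength k)
blockIndex {n = suc n} {k} zero    j = j ↑ˡ totalLength (k ∘ suc)
blockIndex {n = suc n} {k} (suc i) j = k zero ↑ʳ blockIndex i j

module _ {A : Set e} where

  block : {k : Fin n → ℕ} → Vec A (totalLength k) → ∀ i → Vec A (k i)
  block as i = tabulate λ j → lookup as (blockIndex i j)

  flatten : {k : Fin n → ℕ} → (∀ i → Vec A (k i)) → Vec A (totalLength k)
  flatten {n = zero}  ass = []
  flatten {n = suc n} ass = ass zero ++ flatten (ass ∘ suc)

  lookup-flatten : {k : Fin n → ℕ} (ass : ∀ i → Vec A (k i)) → ∀ i j →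
                   lookup (flatten ass) (blockIndex i j) ≡ lookup (ass i) j
  lookup-flatten ass zero    j = lookup-++ˡ (ass zero) (flatten (ass ∘ suc)) j
  lookup-flatten ass (suc i) j =
    trans (lookup-++ʳ (ass zero) (flatten (ass ∘ suc)) (blockIndex i j))
          (lookup-flatten (ass ∘ suc) i j)

  block-flatten : {k : Fin n → ℕ} (ass : ∀ i → Vec A (k i)) → ∀ i →
                  block (flatten ass) i ≡ ass i
  block-flatten ass i =
    trans (tabulate-cong (lookup-flatten ass i)) (tabulate∘lookup (ass i))

combine-cong : {A : Set p} (ε : BoolExpr n) {B B′ : Fin n → Pred A c} {x : A} →
               (∀ i → B i x ⇔ B′ i x) → combine ε B x ⇔ combine ε B′ x
combine-cong (gen i)    B⇔B′ = B⇔B′ i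
combine-cong empty      B⇔B′ = ⇔-id _
combine-cong (compl ε)  B⇔B′ = ¬-cong-⇔ (combine-cong ε B⇔B′)
combine-cong (meet ε η) B⇔B′ = combine-cong ε B⇔B′ ×-⇔ combine-cong η B⇔B′
combine-cong (join ε η) B⇔B′ = combine-cong ε B⇔B′ ⊎-⇔ combine-cong η B⇔B′

-- Sides of sets

same-or-not : ∀ s t → s ≡ t ⊎ s ≡ not t
same-or-not false false = inj₁ refl
same-or-not false true  = inj₂ refl
same-or-not true  false = inj₂ refl
same-or-not true  true  = inj₁ refl

^-cong : ∀ {A : Set p} {B B′ : Pred A c} {x} b → B x ⇔ B′ x → (B ^ b) x ⇔ (B′ ^ b) x
^-cong true  B⇔B′ = B⇔B′
^-cong false B⇔B′ = ¬-cong-⇔ B⇔B′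

^-mono-≐ : ∀ {A : Set p} {B B′ : Pred A c} b → B ≐ B′ → (B ^ b) ⊆ (B′ ^ b)
^-mono-≐ b (B⊆B′ , B′⊆B) = to (^-cong b (mk⇔ B⊆B′ B′⊆B))

module _ {A : Set p} (B : Pred A c) where

  ^-exclusive : ∀ b {x} → (B ^ b) x → ¬ (B ^ not b) x
  ^-exclusive true  Bx  ¬Bx = ¬Bx Bx
  ^-exclusive false ¬Bx Bx  = ¬Bx Bx

  -- This describes the side of `B` through `a` without naming a Boolean, so one formula expresses
  -- it for all instances.
  SameSide : A → Pred A c
  SameSide a x = (B x → B a) × (B a → B x)

  sameSide⇔^ : ∀ {a} b → (B ^ b) a → ∀ {x} → SameSide a x ⇔ (B ^ b) x
  sameSide⇔^ true  Ba  = mk⇔ (λ (_ , f) → f Ba) (λ Bx → (λ _ → Ba) , (λ _ → Bx))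
  sameSide⇔^ false ¬Ba = mk⇔ (λ (f , _) → ¬Ba ∘ f)
                             (λ ¬Bx → ⊥-elim ∘ ¬Bx , ⊥-elim ∘ ¬Ba)

  module _ (em : ∀ a → ExcludedMiddle a) where

    ^-exhaustive : ∀ b {x} → ¬ (B ^ b) x → (B ^ not b) x
    ^-exhaustive true  ¬Bx  = ¬Bx
    ^-exhaustive false ¬¬Bx = decidable-stable (em c) ¬¬Bx

    side : ∀ x → ∃[ b ] (B ^ b) x
    side x with em c {B x}
    ... | yes Bx = true , Bx
    ... | no ¬Bx = false , ¬Bx

module _ (em : ∀ a → ExcludedMiddle a) {A : Set p} (B B′ : Pred A c) where

  contraposition : ∀ s t → (B ^ not s) ⊆ (B′ ^ t) → (B′ ^ not t) ⊆ (B ^ s)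
  contraposition s t B⊆B′ {x} B′x = decidable-stable (em c) λ ¬Bx →
    ^-exclusive B′ t (B⊆B′ (^-exhaustive B em s ¬Bx)) B′x

  module _ (dependent : ¬ (B ≐ B′) → ¬ Independent B B′) where

    -- If the sets differ, dependence makes some intersection of two sides empty, which is an
    -- inclusion of one side in the opposite of the other.
    nested-sides : B ≐ B′ ⊎ (∃[ s ] ∃[ t ] (B ^ s) ⊆ (B′ ^ t))
    nested-sides with em (c ⊔ p) {B ≐ B′}
    ... | yes B≐B′ = inj₁ B≐B′
    ... | no  B≢B′ with em (c ⊔ p) {∃[ s ] ∃[ t ] ¬ Satisfiable ((B ^ s) ∩ (B′ ^ t))}
    ... | yes (s , t , disjoint) = inj₂ (s , not t , λ {x} Bx →
            ^-exhaustive B′ em t λ B′x → disjoint (x , Bx , B′x))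
    ... | no  none = ⊥-elim (dependent B≢B′ λ s t →
            decidable-stable (em (c ⊔ p)) λ disjoint → none (s , t , disjoint))

    -- As `B ^ s` meets both sides of `B′`, it is contained in neither. So the inclusion from
    -- `nested-sides` starts at the opposite side, and complements reverse it.
    side-inside : ∀ s → (∀ t → Satisfiable ((B ^ s) ∩ (B′ ^ t))) →
                  ∃[ t ] (B′ ^ t) ⊆ (B ^ s)
    side-inside s meets with nested-sides
    ... | inj₁ (B⊆B′ , B′⊆B) = s , ^-mono-≐ s (B′⊆B , B⊆B′)
    ... | inj₂ (s′ , t , B⊆B′) with same-or-not s′ s
    ...   | inj₁ refl = let x , Bx , B′x = meets (not t)
                        in ⊥-elim (^-exclusive B′ t (B⊆B′ Bx) B′x)
    ...   | inj₂ refl = not t , contraposition s t B⊆B′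

    -- Among the four possible inclusions of `nested-sides`, `a` refutes one mixed case and `b` the
    -- other. The remaining two compare the sides, one of them after taking complements.
    sides-comparable : ∀ s t {a b} → (B ^ s) a → (B′ ^ t) a → ¬ (B ^ s) b → ¬ (B′ ^ t) b →
                       (B ^ s) ⊆ (B′ ^ t) ⊎ (B′ ^ t) ⊆ (B ^ s)
    sides-comparable s t {a} {b} Ba B′a ¬Bb ¬B′b with nested-sides
    ... | inj₁ B≐B′ with same-or-not s t
    ...   | inj₁ refl = inj₁ (^-mono-≐ s B≐B′)
    ...   | inj₂ refl = ⊥-elim (^-exclusive B′ t B′a (^-mono-≐ (not t) B≐B′ Ba))
    sides-comparable s t {a} {b} Ba B′a ¬Bb ¬B′b
        | inj₂ (s′ , t′ , B⊆B′) with same-or-not s′ s | same-or-not t′ t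
    ...   | inj₁ refl | inj₁ refl = inj₁ B⊆B′
    ...   | inj₁ refl | inj₂ refl = ⊥-elim (^-exclusive B′ t B′a (B⊆B′ Ba))
    ...   | inj₂ refl | inj₁ refl = ⊥-elim (¬B′b (B⊆B′ (^-exhaustive B em s ¬Bb)))
    ...   | inj₂ refl | inj₂ refl =
      inj₂ (λ {x} B′x → decidable-stable (em c) λ ¬Bx →
              ^-exclusive B′ t B′x (B⊆B′ (^-exhaustive B em s ¬Bx)))

-- Renaming of variables and definability

module _ {L : Language ℓ} where

  mutual
    renameTerm : (Fin n → Fin m) → Term L n → Term L m
    renameTerm ρ (var i)    = var (ρ i)
    renameTerm ρ (app f ts) = app f (renameTerms ρ ts)

    renameTerms : ∀ {k} → (Fin n → Fin m) → Vec (Term L n) k → Vec (Term L m) k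
    renameTerms ρ []       = []
    renameTerms ρ (t ∷ ts) = renameTerm ρ t ∷ renameTerms ρ ts

  rename : (Fin n → Fin m) → Formula L n → Formula L m
  rename ρ Bot         = Bot
  rename ρ (Eq s t)    = Eq (renameTerm ρ s) (renameTerm ρ t)
  rename ρ (Atom R ts) = Atom R (renameTerms ρ ts)
  rename ρ (And φ ψ)   = And (rename ρ φ) (rename ρ ψ)
  rename ρ (Or φ ψ)    = Or (rename ρ φ) (rename ρ ψ)
  rename ρ (Imp φ ψ)   = Imp (rename ρ φ) (rename ρ ψ)
  rename ρ (All φ)     = All (rename (liftFin 1 ρ) φ)
  rename ρ (Ex φ)      = Ex (rename (liftFin 1 ρ) φ)

module _ {L : Language ℓ} (M : Structure L c) where
  open Structure M using (fun; rel) renaming (Carrier to C; nonempty to default)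

  module _ {ρ : Fin n → Fin m} {v : Vec C n} {w : Vec C m}
           (agree : ∀ i → lookup w (ρ i) ≡ lookup v i) where
    mutual
      eval-rename : ∀ t → eval M (renameTerm ρ t) w ≡ eval M t v
      eval-rename (var i)    = agree i
      eval-rename (app f ts) = cong (fun f) (evals-rename ts)

      evals-rename : ∀ {k} (ts : Vec (Term L n) k) →
                     evals M (renameTerms ρ ts) w ≡ evals M ts v
      evals-rename []       = refl
      evals-rename (t ∷ ts) = cong₂ _∷_ (eval-rename t) (evals-rename ts)

  lift-agree : {ρ : Fin n → Fin m} {v : Vec C n} {w : Vec C m} →
               (∀ i → lookup w (ρ i) ≡ lookup v i) → ∀ a i →
               lookup (a ∷ w) (liftFin 1 ρ i) ≡ lookup (a ∷ v) i
  lift-agree agree a zero    = refl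
  lift-agree agree a (suc i) = agree i

  ⊨-rename : {ρ : Fin n → Fin m} {v : Vec C n} {w : Vec C m} →
             (∀ i → lookup w (ρ i) ≡ lookup v i) → ∀ φ →
             M ⊨ rename ρ φ [ w ] ⇔ M ⊨ φ [ v ]
  ⊨-rename agree Bot         = ⇔-id _
  ⊨-rename agree (Eq s t)    =
    ≡⇒⇔ (cong₂ _≡_ (eval-rename agree s) (eval-rename agree t))
  ⊨-rename agree (Atom R ts) = ≡⇒⇔ (cong (rel R) (evals-rename agree ts))
  ⊨-rename agree (And φ ψ)   = ⊨-rename agree φ ×-⇔ ⊨-rename agree ψ
  ⊨-rename agree (Or φ ψ)    = ⊨-rename agree φ ⊎-⇔ ⊨-rename agree ψ
  ⊨-rename agree (Imp φ ψ)   = →-cong-⇔ (⊨-rename agree φ) (⊨-rename agree ψ)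
  ⊨-rename agree (All φ)     = ∀-cong-⇔ λ a → ⊨-rename (lift-agree agree a) φ
  ⊨-rename agree (Ex φ)      = ∃-cong-⇔ λ a → ⊨-rename (lift-agree agree a) φ

  -- A type of points with its coordinate functions.  Definability over
  -- base V is by a formula whose parameters depend arbitrarily on V, and
  -- n ▹ E adds n variables that may be quantified.
  record Env (e : Level) : Set (lsuc (c ⊔ e)) where
    field
      Point        : Set e
      IsCoord      : (Point → C) → Set (c ⊔ e)
      const-coord  : ∀ a → IsCoord (λ _ → a)
      resp-coord   : ∀ {f g} → (∀ x → f x ≡ g x) → IsCoord g → IsCoord f

  open Env public

  base : Set e → Env e
  base V = record { Point = V ; IsCoord = λ _ → ⊤ }

  infixr 5 _▹_
  _▹_ : ℕ → Env e → Env (c ⊔ e)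
  n ▹ E = record
    { Point       = Vec C n × Point E
    ; IsCoord     = λ f → (∃[ i ] ∀ x → f x ≡ lookup (proj₁ x) i) ⊎
                          (∃[ g ] IsCoord E g × ∀ x → f x ≡ g (proj₂ x))
    ; const-coord = λ a → inj₂ ((λ _ → a) , const-coord E a , λ _ → refl)
    ; resp-coord  = λ f≗g → λ where
        (inj₁ (i , g≗))     → inj₁ (i , λ x → trans (f≗g x) (g≗ x))
        (inj₂ (h , hc , g≗)) → inj₂ (h , hc , λ x → trans (f≗g x) (g≗ x))
    }

  var-coord : {E : Env e} (i : Fin n) → IsCoord (n ▹ E) (λ x → lookup (proj₁ x) i)
  var-coord i = inj₁ (i , λ _ → refl)

  weaken-coord : {E : Env e} {f : Point E → C} → IsCoord E f →
                 IsCoord (n ▹ E) (λ x → f (proj₂ x))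
  weaken-coord fc = inj₂ (_ , fc , λ _ → refl)

  IsTuple : (E : Env e) → (Point E → Vec C n) → Set (c ⊔ e)
  IsTuple E f = ∀ i → IsCoord E (λ x → lookup (f x) i)

  ++-tuple : {E : Env e} {f : Point E → Vec C m} {g : Point E → Vec C n} →
             IsTuple E f → IsTuple E g → IsTuple E (λ x → f x ++ g x)
  ++-tuple {m = m} {E = E} {f} {g} ft gt i =
    resp-coord E (λ x → lookup-splitAt m (f x) (g x) i) (choose (splitAt m i))
    where
    choose : ∀ j → IsCoord E (λ x → [ lookup (f x) , lookup (g x) ]′ j)
    choose (inj₁ j) = ft j
    choose (inj₂ j) = gt j

  tabulate-tuple : {E : Env e} {f : Fin n → Point E → C} →
                   (∀ i → IsCoord E (f i)) →
                   IsTuple E (λ x → tabulate (λ i → f i x))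
  tabulate-tuple {E = E} {f} fc i =
    resp-coord E (λ x → lookup∘tabulate (λ j → f j x) i) (fc i)

  -- A substitution: `pull-back` is what keeps definable relations definable under composition with
  -- `apply`.
  record EnvMap (E : Env e) (E′ : Env e′) : Set (c ⊔ e ⊔ e′) where
    constructor envMap
    field
      apply     : Point E → Point E′
      pull-back : ∀ f → IsCoord E′ f → IsCoord E (f ∘ apply)

  open EnvMap public

  pair-map : {E : Env e} {E′ : Env e′} {f : Point E → Vec C n} →
             IsTuple E f → EnvMap E E′ → EnvMap E (n ▹ E′)
  pair-map {E = E} {f = f} ft μ = envMap (λ x → f x , apply μ x) λ where
    g (inj₁ (i , g≗))      → resp-coord E (λ x → g≗ (f x , apply μ x)) (ft i)
    g (inj₂ (h , hc , g≗)) →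
      resp-coord E (λ x → g≗ (f x , apply μ x)) (pull-back μ h hc)

  drop-map : {E : Env e} {E′ : Env e′} → EnvMap E E′ → EnvMap (n ▹ E) E′
  drop-map {E = E} μ = envMap (apply μ ∘ proj₂) λ g gc →
    weaken-coord {E = E} (pull-back μ g gc)

  id-map : {E : Env e} → EnvMap E E
  id-map = envMap id λ _ gc → gc

  record Definable (E : Env e) (P : Point E → Set p) : Set (ℓ ⊔ c ⊔ e ⊔ p) where
    field
      {size}  : ℕ
      formula : Formula L size
      args    : Point E → Vec C size
      isTuple : IsTuple E args
      defines : ∀ x → P x ⇔ M ⊨ formula [ args x ]

  open Definable

  module _ {E : Env e} where

    formula-def : (φ : Formula L n) (f : Point E → Vec C n) → IsTuple E f →
                  Definable E (λ x → M ⊨ φ [ f x ])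
    formula-def φ f ft = record
      { formula = φ ; args = f ; isTuple = ft ; defines = λ _ → ⇔-id _ }

    resp-def : {P : Point E → Set p} {Q : Point E → Set q} →
               (∀ x → Q x ⇔ P x) → Definable E P → Definable E Q
    resp-def Q⇔P D = record
      { formula = formula D ; args = args D ; isTuple = isTuple D
      ; defines = λ x → defines D x ⇔-∘ Q⇔P x }

    module _ {P : Point E → Set p} {Q : Point E → Set q}
             (D₁ : Definable E P) (D₂ : Definable E Q) where
      private
        n₁ = size D₁
        n₂ = size D₂

      -- The argument tuples are concatenated and each formula is renamed into its own half, so
      -- shared variables never have to be identified.
      connective-def :
        (op : ∀ {k} → Formula L k → Formula L k → Formula L k)
        (Op : ∀ {a b} → Set a → Set b → Set (a ⊔ b)) →
        (∀ {k} {φ ψ : Formula L k} {v} →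
           M ⊨ op φ ψ [ v ] ⇔ Op (M ⊨ φ [ v ]) (M ⊨ ψ [ v ])) →
        (∀ {a a′ b b′} {A : Set a} {A′ : Set a′} {B : Set b} {B′ : Set b′} →
           A ⇔ A′ → B ⇔ B′ → Op A B ⇔ Op A′ B′) →
        Definable E (λ x → Op (P x) (Q x))
      connective-def op Op sem Op-cong = record
        { formula = op (rename (_↑ˡ n₂) (formula D₁)) (rename (n₁ ↑ʳ_) (formula D₂))
        ; args    = λ x → args D₁ x ++ args D₂ x
        ; isTuple = ++-tuple {E = E} {args D₁} {args D₂} (isTuple D₁) (isTuple D₂)
        ; defines = λ x →
            ⇔-sym sem ⇔-∘
            Op-cong
              (⇔-sym (⊨-rename (lookup-++ˡ (args D₁ x) (args D₂ x)) (formula D₁))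
                 ⇔-∘ defines D₁ x)
              (⇔-sym (⊨-rename (lookup-++ʳ (args D₁ x) (args D₂ x)) (formula D₂))
                 ⇔-∘ defines D₂ x)
        }

      and-def : Definable E (λ x → P x × Q x)
      and-def = connective-def And _×_ (⇔-id _) _×-⇔_

      or-def : Definable E (λ x → P x ⊎ Q x)
      or-def = connective-def Or _⊎_ (⇔-id _) _⊎-⇔_

      imp-def : Definable E (λ x → P x → Q x)
      imp-def = connective-def Imp (λ A B → A → B) (⇔-id _) →-cong-⇔

    false-def : {P : Point E → Set p} → (∀ x → ¬ P x) → Definable E P
    false-def ¬P = record
      { formula = Bot ; args = λ _ → [] ; isTuple = λ ()
      ; defines = λ x → mk⇔ (λ Px → ⊥-elim (¬P x Px)) (λ ()) }

    not-def : {P : Point E → Set p} → Definable E P → Definable E (λ x → ¬ P x)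
    not-def D = imp-def D (false-def λ _ → id)

    true-def : {P : Point E → Set p} → (∀ x → P x) → Definable E P
    true-def Px = resp-def (λ x → mk⇔ (λ _ → id) (λ _ → Px x))
                           (not-def (false-def {P = λ _ → ⊥} λ _ → id))

    all-def : ∀ {i} {I : Set i} {P : I → Point E → Set p} → (∀ i → Definable E (P i)) →
              ∀ is → Definable E (λ x → ListAll.All (λ i → P i x) is)
    all-def Ds []       = true-def λ _ → []
    all-def Ds (i ∷ is) =
      resp-def (λ _ → mk⇔ ListAll.uncons (λ (x , xs) → x ∷ xs))
               (and-def (Ds i) (all-def Ds is))

  pull-def : {E : Env e} {E′ : Env e′} {P : Point E′ → Set p} →
             Definable E′ P → (μ : EnvMap E E′) → Definable E (P ∘ apply μ)
  pull-def D μ = record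
    { formula = formula D ; args = args D ∘ apply μ
    ; isTuple = λ i → pull-back μ _ (isTuple D i)
    ; defines = λ x → defines D (apply μ x) }

  -- Normal form for one variable and quantifiers

  record FirstVar (E : Env e) (P : Point (1 ▹ E) → Set p) : Set (ℓ ⊔ c ⊔ e ⊔ p) where
    field
      {size′}  : ℕ
      formula′ : Formula L (suc size′)
      args′    : Point E → Vec C size′
      isTuple′ : IsTuple E args′
      defines′ : ∀ a x → P (a ∷ [] , x) ⇔ M ⊨ formula′ [ a ∷ args′ x ]

  open FirstVar public

  -- Every argument is either the new variable or a coordinate of `E`. Arguments of the first kind
  -- are all redirected to variable 0, which is then ready to be bound.
  firstVar : {E : Env e} {P : Point (1 ▹ E) → Set p} →
             Definable (1 ▹ E) P → FirstVar E P
  firstVar {E = E} D = record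
    { formula′ = rename (λ i → index (isTuple D i) i) (formula D)
    ; args′    = λ x → tabulate λ i → rest (isTuple D i) x
    ; isTuple′ = tabulate-tuple {E = E} λ i → rest-coord (isTuple D i)
    ; defines′ = λ a x →
        ⇔-sym (⊨-rename (λ i → index-agree a x (isTuple D i) i (lookup∘tabulate _ i)) (formula D))
          ⇔-∘ defines D (a ∷ [] , x)
    }
    where
    module _ {f : Point (1 ▹ E) → C} where
      rest : IsCoord (1 ▹ E) f → Point E → C
      -- A filler that is never read, because `index` sends this position to variable 0.
      rest (inj₁ _)       = λ _ → default
      rest (inj₂ (g , _)) = g

      rest-coord : (fc : IsCoord (1 ▹ E) f) → IsCoord E (rest fc)
      rest-coord (inj₁ _)            = const-coord E default
      rest-coord (inj₂ (_ , gc , _)) = gc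

      index : IsCoord (1 ▹ E) f → Fin n → Fin (suc n)
      index (inj₁ _) i = zero
      index (inj₂ _) i = suc i

      index-agree : ∀ a x {ws : Vec C n} (fc : IsCoord (1 ▹ E) f) i →
                    lookup ws i ≡ rest fc x →
                    lookup (a ∷ ws) (index fc i) ≡ f (a ∷ [] , x)
      index-agree a x (inj₁ (zero , f≗)) i eq = sym (f≗ (a ∷ [] , x))
      index-agree a x (inj₂ (_ , _ , f≗)) i eq = trans eq (sym (f≗ (a ∷ [] , x)))

  quantifier-def :
    {E : Env e} {P : Point (1 ▹ E) → Set p} {Q : Point E → Set q}
    (op : ∀ {k} → Formula L (suc k) → Formula L k) →
    (∀ {k} {φ : Formula L (suc k)} {v : Vec C k} x →
       (∀ a → P (a ∷ [] , x) ⇔ M ⊨ φ [ a ∷ v ]) → Q x ⇔ M ⊨ op φ [ v ]) →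
    Definable (1 ▹ E) P → Definable E Q
  quantifier-def op sem D = record
    { formula = op (formula′ F) ; args = args′ F ; isTuple = isTuple′ F
    ; defines = λ x → sem x (λ a → defines′ F a x) }
    where F = firstVar D

  ∀₁-def : {E : Env e} {P : Point (1 ▹ E) → Set p} → Definable (1 ▹ E) P →
           Definable E (λ x → ∀ a → P (a ∷ [] , x))
  ∀₁-def = quantifier-def All λ _ → ∀-cong-⇔

  ∃₁-def : {E : Env e} {P : Point (1 ▹ E) → Set p} → Definable (1 ▹ E) P →
           Definable E (λ x → ∃[ a ] P (a ∷ [] , x))
  ∃₁-def = quantifier-def Ex λ _ → ∃-cong-⇔

  -- Splitting off the head lets a quantifier over tuples be treated one variable at a time.
  ∷-map : {E : Env e} → EnvMap (1 ▹ (n ▹ E)) (suc n ▹ E)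
  ∷-map {E = E} = record
    { apply     = λ (a , as , x) → lookup a zero ∷ as , x
    ; pull-back = λ where
        f (inj₁ (zero , f≗))  → inj₁ (zero , λ _ → f≗ _)
        f (inj₁ (suc i , f≗)) → inj₂ (_ , var-coord {E = E} i , λ _ → f≗ _)
        f (inj₂ (g , gc , f≗)) →
          inj₂ (_ , weaken-coord {E = E} gc , λ _ → f≗ _)
    }

  ∃-def : {E : Env e} {P : Point (n ▹ E) → Set p} → Definable (n ▹ E) P →
          Definable E (λ x → ∃[ as ] P (as , x))
  ∃-def {n = zero} D =
    resp-def (λ _ → mk⇔ (λ { ([] , Px) → Px }) (λ Px → [] , Px))
             (pull-def D (pair-map (λ ()) id-map))
  ∃-def {n = suc n} D =
    resp-def (λ _ → mk⇔ (λ { (a ∷ as , Px) → as , a , Px })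
                        (λ (as , a , Px) → a ∷ as , Px))
             (∃-def (∃₁-def (pull-def D ∷-map)))

  -- Saturation

  -- Over a one-point base the coordinates other than the variables are constants, that is,
  -- parameters.
  ParamDefinable : Pred (Vec C n) p → Set (ℓ ⊔ c ⊔ p)
  ParamDefinable {n = n} P = Definable (n ▹ base {0ℓ} ⊤) (P ∘ proj₁)

  module _ (saturated : Saturated M) where

    -- Saturation speaks of small parameter sets while the carrier may be large. The parameters are
    -- therefore indexed by their positions in the formulas, a type in `Set ℓ`.
    saturated₁ : {I : Set ℓ} {Q : I → Pred (Vec C 1) p} →
                 (∀ i → ParamDefinable (Q i)) →
                 (∀ is → ∃[ a ] ListAll.All (λ i → Q i (a ∷ [])) is) →
                 ∃[ a ] ∀ i → Q i (a ∷ [])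
    saturated₁ {I = I} {Q} D finSat =
      let a , real = saturated Index param type λ θs type-θs →
            let is , real = indices θs type-θs
                a , Qa = finSat is
            in a , real a Qa
      in a , λ i → from (Q⇔θ a i) (real (θ i) (i , refl))
      where
      F : ∀ i → FirstVar (base ⊤) (Q i ∘ proj₁)
      F i = firstVar (D i)

      Index : Set _
      Index = Σ[ i ∈ I ] Fin (size′ (F i))

      param : Index → C
      param (i , j) = lookup (args′ (F i) tt) j

      θ : I → ParamFormula M Index
      θ i = size′ (F i) , formula′ (F i) , tabulate (λ j → i , j)

      type : Pred (ParamFormula M Index) _
      type χ = ∃[ i ] χ ≡ θ i

      Q⇔θ : ∀ a i → Q i (a ∷ []) ⇔ Realizes M param a (θ i)
      Q⇔θ a i = ≡⇒⇔ (cong (λ ws → M ⊨ formula′ (F i) [ a ∷ ws ]) params)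
                  ⇔-∘ defines′ (F i) a tt
        where
        params : args′ (F i) tt ≡ map param (tabulate (λ j → i , j))
        params = trans (sym (tabulate∘lookup (args′ (F i) tt)))
                       (tabulate-∘ param (λ j → i , j))

      indices : ∀ θs → ListAll.All type θs → ∃[ is ] ∀ a →
                ListAll.All (λ i → Q i (a ∷ [])) is → ListAll.All (Realizes M param a) θs
      indices []       []                 = [] , λ _ _ → []
      indices (_ ∷ θs) ((i , refl) ∷ type-θs) =
        let is , real = indices θs type-θs
        in i ∷ is , λ { a (Qa ∷ Qas) → to (Q⇔θ a i) Qa ∷ real a Qas }

    -- The first coordinate is chosen so that every finite list of conditions still has a
    -- completion. These requirements are definable and indexed by lists, and finitely many of them
    -- follow from the concatenated list.
    saturatedTuple : ∀ n {I : Set ℓ} {Q : I → Pred (Vec C n) p} →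
                     (∀ i → ParamDefinable (Q i)) →
                     (∀ is → ∃[ as ] ListAll.All (λ i → Q i as) is) →
                     ∃[ as ] ∀ i → Q i as
    saturatedTuple zero {Q = Q} D finSat = [] , λ i → single (finSat (i ∷ []))
      where
      single : ∀ {i} → ∃[ as ] ListAll.All (λ i → Q i as) (i ∷ []) → Q i []
      single ([] , q ∷ []) = q
    saturatedTuple (suc n) {I} {Q} D finSat =
      let a , Q′a   = saturated₁ {I = List I} {Q = Q′} D′ finSat′
          as , Qas = saturatedTuple n {Q = λ i as → Q i (a ∷ as)}
                       (λ i → pull-def (D i) (cons-const a)) Q′a
      in a ∷ as , Qas
      where
      Q′ : List I → Pred (Vec C 1) _
      Q′ is a = ∃[ as ] ListAll.All (λ i → Q i (lookup a zero ∷ as)) is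

      cons : EnvMap (n ▹ 1 ▹ base ⊤) (suc n ▹ base ⊤)
      cons = pair-map {f = λ (as , a , _) → lookup a zero ∷ as}
               (λ where
                  zero    → inj₂ (_ , inj₁ (zero , λ _ → refl) , λ _ → refl)
                  (suc i) → inj₁ (i , λ _ → refl))
               (drop-map (drop-map id-map))

      cons-const : ∀ a → EnvMap (n ▹ base ⊤) (suc n ▹ base ⊤)
      cons-const a = pair-map {f = λ (as , _) → a ∷ as}
               (λ where
                  zero    → inj₂ (_ , tt , λ _ → refl)
                  (suc i) → inj₁ (i , λ _ → refl))
               (drop-map id-map)

      D′ : ∀ is → ParamDefinable (Q′ is)
      D′ is = ∃-def (pull-def (all-def D is) cons)

      finSat′ : ∀ iss → ∃[ a ] ListAll.All (λ is → Q′ is (a ∷ [])) iss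
      finSat′ iss with finSat (concat iss)
      ... | a ∷ as , Qs = a , ListAll.map (as ,_) (concat⁻ {xss = iss} Qs)

    saturated-decreasing : {Q : ℕ → Pred (Vec C n) p} →
                           (∀ k → ParamDefinable (Q k)) →
                           (∀ k → Q (suc k) ⊆ Q k) → (∀ k → Satisfiable (Q k)) →
                           ∃[ as ] ∀ k → Q k as
    saturated-decreasing {n = n} {Q = Q} D Q-dec Q-sat =
      let as , Qas = saturatedTuple n {I = Lift ℓ ℕ} {Q = Q ∘ lower} (D ∘ lower) λ ks →
            let N , below = bound ks
                as , Qas = Q-sat N
            in as , below Qas
      in as , λ k → Qas (lift k)
      where
      descend : ∀ j k → Q (j + k) ⊆ Q k
      descend zero    k Qas = Qas
      descend (suc j) k Qas = descend j k (Q-dec (j + k) Qas)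

      bound : ∀ ks → ∃[ N ] ∀ {as} → Q N as → ListAll.All (λ k → Q (lower k) as) ks
      bound []            = zero , λ _ → []
      bound (lift k ∷ ks) =
        let N , below = bound ks
        -- The sum of the indices serves as a common upper bound.
        in k + N , λ {as} Qas →
             descend N k (subst (λ j → Q j as) (+-comm k N) Qas) ∷ below (descend k N Qas)

  -- Definability of rank and the infinite tree

  module _ (m : ℕ) {n : ℕ} (φ : Formula L (m + n)) where

    relation : Vec C m → Vec C n → Set c
    relation x y = M ⊨ φ [ x ++ y ]

    private
      R = relation

    relation-def : {E : Env e} {f : Point E → Vec C n} → IsTuple E f →
                   Definable (m ▹ E) (λ (x , v) → R x (f v))
    relation-def {E = E} {f} ft =
      formula-def φ (λ (x , v) → x ++ f v)
        (++-tuple {E = m ▹ E} {proj₁} {f ∘ proj₂} (var-coord {E = E})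
                  (λ i → weaken-coord {E = E} (ft i)))

    cut-def : {E : Env e} {f : Point E → Vec C n} → IsTuple E f → ∀ b →
              Definable (m ▹ E) (λ (x , v) → cut R (f v) b x)
    cut-def {E = E} ft true  = relation-def {E = E} ft
    cut-def {E = E} ft false = not-def (relation-def {E = E} ft)

    -- For fixed `h` the labels of the tree and the points at its leaves are finitely many
    -- existential quantifiers.
    Rank≥-def : ∀ h {E : Env e} {P : Point (m ▹ E) → Set c} → Definable (m ▹ E) P →
                Definable E (λ v → Rank≥ R h (λ x → P (x , v)))
    Rank≥-def zero    D = ∃-def D
    Rank≥-def (suc h) {E} {P} D =
      ∃-def (resp-def (λ _ → mk⇔ (λ split → split true , split false)
                                 (λ (t , f) → λ { true → t ; false → f }))
                      (and-def (Rank≥-def h (half true)) (Rank≥-def h (half false))))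
      where
      half : ∀ b → Definable (m ▹ n ▹ E) (λ (x , y , v) → P (x , v) × cut R y b x)
      half b = and-def (pull-def D (pair-map (var-coord {E = n ▹ E}) (drop-map (drop-map id-map))))
                       (cut-def {E = n ▹ E} {proj₁} (var-coord {E = E}) b)

    module Tree (saturated : Saturated M) (infinite : ∀ h → Rank≥ R h (λ _ → ⊤)) where

      -- Definability of the branch is carried along because saturation is applied to it when the
      -- next label is chosen.
      record Node : Set (ℓ ⊔ lsuc c) where
        field
          Branch     : Pred (Vec C m) c
          branch-def : ParamDefinable Branch
          rank-∞     : ∀ h → Rank≥ R h Branch

      open Node

      abstract
        -- Rank at least `suc h` gives a label good for `h`. These conditions on `y` decrease with
        -- `h`, so saturation yields one label good for all `h`.
        splitting : (N : Node) → ∃[ y ] ∀ h b → Rank≥ R h (Branch N ∩ cut R y b)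
        splitting N = saturated-decreasing saturated def
                        (λ h → λ split b → Rank≥-pred R h (split b))
                        (λ h → rank-∞ N (suc h))
          where
          half : ∀ b → Definable (m ▹ n ▹ base {0ℓ} ⊤) (λ (x , y , _) → Branch N x × cut R y b x)
          half b = and-def (pull-def (branch-def N)
                              (pair-map (var-coord {E = n ▹ base ⊤}) (drop-map (drop-map id-map))))
                           (cut-def {E = n ▹ base ⊤} {proj₁} (var-coord {E = base ⊤}) b)

          def : ∀ h → ParamDefinable (λ y → ∀ b → Rank≥ R h (Branch N ∩ cut R y b))
          def h = resp-def (λ _ → mk⇔ (λ split → split true , split false)
                                      (λ (t , f) → λ { true → t ; false → f }))
                           (and-def (Rank≥-def h (half true)) (Rank≥-def h (half false)))

      child : Bool → Node → Node
      child b N = record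
        { Branch     = Branch N ∩ cut R y b
        ; branch-def = and-def (branch-def N)
            (cut-def {E = base ⊤} {λ _ → y} _ b)
        ; rank-∞     = λ h → proj₂ (splitting N) h b
        }
        where y = proj₁ (splitting N)

      -- The most recent turn is the head of the list, and the root is its end.
      node : List Bool → Node
      node []      = record
        { Branch = λ _ → ⊤ ; branch-def = true-def _ ; rank-∞ = infinite }
      node (b ∷ s) = child b (node s)

      label : List Bool → Vec C n
      label s = proj₁ (splitting (node s))

      cone : List Bool → Pred (Vec C m) c
      cone s = Branch (node s)

      cone-nonempty : ∀ s → Satisfiable (cone s)
      cone-nonempty s = rank-∞ (node s) zero

      module _ (turn : ℕ → List Bool → Bool) where

        path : ℕ → List Bool
        path zero    = []
        path (suc k) = turn k (path k) ∷ path k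

        path-realised : ∃[ x ] ∀ k → cone (path k) x
        path-realised = saturated-decreasing saturated (λ k → branch-def (node (path k)))
                          (λ k → proj₁) (λ k → cone-nonempty (path k))

      uncountablyManyTypes : (∀ a → ExcludedMiddle a) →
                             ¬ CountablyManyTypes (λ x s → R x (label s))
      uncountablyManyTypes em (S , type) = contradiction
        where
        turn : ℕ → List Bool → Bool
        -- At level `k` the path turns against what the `k`-th type predicts for the current label.
        turn k s = not (does (em c {S k s}))

        contradiction : ⊥
        contradiction =
          let x , on-path = path-realised turn
              k , R⇔S     = type x
          in wrong-side (em c) (proj₂ (on-path (suc k))) (R⇔S (path turn k))

  -- Definability of types of finite rank

  -- Indices are nodes, since the types are to be compared with tree labels. Over `base (List Bool)`
  -- the parameters may depend on the node in any way.
  TypesCountable : ℕ → Set (ℓ ⊔ lsuc c)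
  TypesCountable m = {S : Vec C m → List Bool → Set c} →
                     Definable (m ▹ base (List Bool)) (uncurry S) → CountablyManyTypes S

  types-countable₀ : TypesCountable 0
  types-countable₀ {S} _ = (λ _ → S []) , λ { [] → zero , λ _ → ⇔-id _ }

  module _ (em : ∀ a → ExcludedMiddle a) (φ : Formula L (1 + n))
           (finiteRank : ∃[ h ] ¬ Rank≥ (relation 1 φ) h (λ _ → ⊤))
           {g : Vec C m × List Bool → Vec C n} (g-tuple : IsTuple (m ▹ base (List Bool)) g)
           where
    private
      R = relation 1 φ

      -- A condition names an index and a sign instead of a parameter, so there are countably many
      -- lists of conditions, the same for every `as`.
      Conditions : Set
      Conditions = List (List Bool × Bool)

      cell : Conditions → Vec C m → Pred (Vec C 1) c
      cell K as a = ListAll.All (λ (s , b) → cut R (g (as , s)) b a) K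

      cell-def : ∀ K → Definable (1 ▹ m ▹ base (List Bool)) (λ (a , as , _) → cell K as a)
      cell-def = all-def λ (s , b) →
        cut-def 1 φ {E = m ▹ base (List Bool)}
          {λ (as , _) → g (as , s)} (λ i → pull-back (fixed s) _ (g-tuple i)) b
        where
        fixed : List Bool → EnvMap (m ▹ base (List Bool)) (m ▹ base (List Bool))
        -- Freezing the index turns the parameters at `s` into constants, and only `as` still
        -- varies.
        fixed s = pair-map {f = proj₁} (var-coord {E = base (List Bool)})
          (envMap (λ _ → s) λ f _ → inj₂ ((λ _ → f s) , _ , λ _ → refl))

      MinimalRank : Vec C 1 → Vec C m → ℕ → Conditions → Set c
      MinimalRank a as r K =
        cell K as a × ¬ Rank≥ R (suc r) (cell K as) ×
        (∀ K′ → cell K′ as a → Rank≥ R r (cell K′ as))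

      -- Start with no conditions and the bound for the whole space, and pass to a cell of smaller
      -- rank while there is one. The bound drops each time, and a cell containing `a` is nonempty.
      minimalRank : ∀ a as → ∃[ r ] ∃[ K ] MinimalRank a as r K
      minimalRank a as = descend (proj₁ finiteRank) [] []
        λ rank → proj₂ finiteRank (Rank≥-mono R (proj₁ finiteRank) _ rank)
        where
        descend : ∀ h K → cell K as a → ¬ Rank≥ R h (cell K as) →
                  ∃[ r ] ∃[ K ] MinimalRank a as r K
        descend zero    K a∈K small = ⊥-elim (small (a , a∈K))
        descend (suc h) K a∈K small
          with em c {∃[ K′ ] cell K′ as a × ¬ Rank≥ R h (cell K′ as)}
        ... | yes (K′ , a∈K′ , small′) = descend h K′ a∈K′ small′
        ... | no none = h , K , a∈K , small , λ K′ a∈K′ →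
          decidable-stable (em c) λ small′ → none (K′ , a∈K′ , small′)

      -- The rank of a minimal cell defines the type: adding a condition
      -- that holds at a keeps the rank, and both halves cannot keep it.
      minimalRank-defines : ∀ {a as r K} → MinimalRank a as r K → ∀ s →
        R a (g (as , s)) ⇔ Rank≥ R r (cell ((s , true) ∷ K) as)
      minimalRank-defines {a} {as} {r} {K} (a∈K , small , large) s = mk⇔
        (λ Ra → large ((s , true) ∷ K) (Ra ∷ a∈K))
        (λ rank → decidable-stable (em c) λ ¬Ra → small (g (as , s) , λ where
           true  → Rank≥-mono R r (λ { (Rx ∷ x∈K) → x∈K , Rx }) rank
           false → Rank≥-mono R r (λ { (¬Rx ∷ x∈K) → x∈K , ¬Rx })
                     (large ((s , false) ∷ K) (¬Ra ∷ a∈K))))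

    -- By `minimalRank-defines`, the type of `(a , as)` is determined by `r`, `K` and the type of
    -- `as` for a rank formula in which `a` no longer occurs. The hypothesis on `m` variables counts
    -- the latter.
    types-countable-fibre :
      TypesCountable m →
      CountablyManyTypes {X = Vec C 1 × Vec C m} (λ (a , as) s → R a (g (as , s)))
    types-countable-fibre ih =
      types-indexed-by
        (Σ-enumerable ℕ-enumerable λ _ →
         Σ-enumerable (List-enumerable (Σ-enumerable (List-enumerable Bool-enumerable)
                                                     λ _ → Bool-enumerable)) λ _ →
         ℕ-enumerable)
        (λ (r , K , k) → proj₁ (rank-types r K) k)
        λ (a , as) →
          let r , K , minimal = minimalRank a as
              k , eq          = proj₂ (rank-types r K) as
          in (r , K , k) , λ s → eq s ⇔-∘ minimalRank-defines minimal s
      where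
      rank-types : ∀ r K →
        CountablyManyTypes (λ as s → Rank≥ R r (cell ((s , true) ∷ K) as))
      rank-types r K = ih (Rank≥-def 1 φ r
        (resp-def (λ _ → mk⇔ ListAll.uncons (λ (x , xs) → x ∷ xs))
           (and-def (cut-def 1 φ {E = m ▹ base (List Bool)} {g} g-tuple true) (cell-def K))))

  -- Formulas of independence dimension at most 1

  module _ (em : ∀ a → ExcludedMiddle a) (ψ : Formula L (suc n)) where
    private
      B : Vec C n → Pred C c
      B = instanceSet M ψ

    cut⇔instanceSet : ∀ y b {a} → cut (relation 1 ψ) y b (a ∷ []) ⇔ (B y ^ b) a
    cut⇔instanceSet y true  = ⇔-id _
    cut⇔instanceSet y false = ⇔-id _

    singleton : {P : Pred (Vec C 1) p} → ∃ P → ∃[ a ] P (a ∷ [])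
    singleton (a ∷ [] , Pa) = a , Pa

    -- The common points `inner` and `outer` are what will force comparability with all other
    -- instances that separate them.
    record StrictChain : Set c where
      field
        instances    : ℕ → Vec C n
        sides        : ℕ → Bool
        inner outer  : C
        inner-∈      : ∀ k → (B (instances k) ^ sides k) inner
        outer-∉      : ∀ k → ¬ (B (instances k) ^ sides k) outer
        decreasing   : ∀ k → (B (instances (suc k)) ^ sides (suc k)) ⊆
                             (B (instances k) ^ sides k)
        strict       : ∀ k → ∃[ x ] (B (instances k) ^ sides k) x ×
                                    ¬ (B (instances (suc k)) ^ sides (suc k)) x

    module _ (saturated : Saturated M) (dim : IndependenceDimension≤1 M ψ)
             (infinite : ∀ h → Rank≥ (relation 1 ψ) h (λ _ → ⊤)) where

      open Tree 1 ψ saturated infinite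

      private
        abstract
          -- Below the b-half of the splitting at s, the next instance still
          -- splits the cone, so one of its two sides lies inside that half.
          meets : ∀ b s t → Satisfiable ((B (label s) ^ b) ∩ (B (label (b ∷ s)) ^ t))
          meets b s t =
            let a , (_ , a∈b) , a∈t = singleton (cone-nonempty (t ∷ b ∷ s))
            in a , to (cut⇔instanceSet (label s) b) a∈b ,
                   to (cut⇔instanceSet (label (b ∷ s)) t) a∈t

          inside : ∀ b s → ∃[ t ] (B (label (b ∷ s)) ^ t) ⊆ (B (label s) ^ b)
          inside b s = side-inside em (B (label s)) (B (label (b ∷ s)))
                         (dim (label s) (label (b ∷ s))) b (meets b s)

        turn : List Bool → Bool
        -- The first turn is arbitrary. Each later one picks the side of the current label that lies
        -- inside the half chosen before.
        turn []      = true
        turn (b ∷ s) = proj₁ (inside b s)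

        walk : ℕ → List Bool
        walk = path (λ _ → turn)

        Side-of : ℕ → Pred C c
        Side-of k = B (label (walk k)) ^ turn (walk k)

        shrinking : ∀ k → Side-of (suc k) ⊆ Side-of k
        shrinking k = proj₂ (inside (turn (walk k)) (walk k))

        properly : ∀ k → ∃[ x ] Side-of k x × ¬ Side-of (suc k) x
        properly k =
          -- The current half also meets the side that is not chosen next, and a point there
          -- witnesses strictness.
          let x , x∈ , x∉ = meets (turn (walk k)) (walk k) (not (turn (walk (suc k))))
          in x , x∈ , λ x∈t →
               ^-exclusive (B (label (walk (suc k)))) (turn (walk (suc k))) x∈t x∉

        walk-realised : ∃[ a ] ∀ k → Side-of k a
        walk-realised =
          let a , on-walk = singleton (path-realised (λ _ → turn))
          in a , λ k → to (cut⇔instanceSet (label (walk k)) (turn (walk k)))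
                          (proj₂ (on-walk (suc k)))

        -- A point on the `false` side of the root label misses the first side of the walk, hence
        -- all the smaller ones.
        excluded : ∃[ a ] ∀ k → ¬ Side-of k a
        excluded = proj₁ apart , outside
          where
          apart : ∃[ a ] cone (false ∷ []) (a ∷ [])
          apart = singleton (cone-nonempty (false ∷ []))

          outside : ∀ k → ¬ Side-of k (proj₁ apart)
          outside zero    a∈ = proj₂ (proj₂ apart) a∈
          outside (suc k) a∈ = outside k (shrinking k a∈)

      strictChain : StrictChain
      strictChain = record
        { instances  = label ∘ walk
        ; sides      = turn ∘ walk
        ; inner      = proj₁ walk-realised
        ; outer      = proj₁ excluded
        ; inner-∈    = proj₂ walk-realised
        ; outer-∉    = proj₂ excluded
        ; decreasing = shrinking
        ; strict     = properly
        }

    -- The definable linear order given by a strict chain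

    private
      variable N : ℕ

      point-index : Fin N → (Fin n → Fin N) → Fin (suc n) → Fin N
      point-index i ι zero    = i
      point-index i ι (suc j) = ι j

    instanceF : Fin N → (Fin n → Fin N) → Formula L N
    instanceF i ι = rename (point-index i ι) ψ

    sameSideF : Fin N → Fin N → (Fin n → Fin N) → Formula L N
    sameSideF a i ι = And (Imp (instanceF i ι) (instanceF a ι))
                          (Imp (instanceF a ι) (instanceF i ι))

    insideF : Fin N → (Fin n → Fin N) → (Fin n → Fin N) → Formula L N
    insideF a ι κ = All (Imp (sameSideF (suc a) zero (suc ∘ ι))
                             (sameSideF (suc a) zero (suc ∘ κ)))

    module _ {w : Vec C N} {y : Vec C n} {ι : Fin n → Fin N}
             (y≗ : ∀ j → lookup w (ι j) ≡ lookup y j) where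

      instanceF-⊨ : ∀ {i a} → lookup w i ≡ a → M ⊨ instanceF i ι [ w ] ⇔ B y a
      instanceF-⊨ i≡ = ⊨-rename (λ { zero → i≡ ; (suc j) → y≗ j }) ψ

      sameSideF-⊨ : ∀ {i a x₀ x} → lookup w a ≡ x₀ → lookup w i ≡ x →
                    M ⊨ sameSideF a i ι [ w ] ⇔ SameSide (B y) x₀ x
      sameSideF-⊨ a≡ i≡ = →-cong-⇔ (instanceF-⊨ i≡) (instanceF-⊨ a≡) ×-⇔
                          →-cong-⇔ (instanceF-⊨ a≡) (instanceF-⊨ i≡)

    insideF-⊨ : {w : Vec C N} {y z : Vec C n} {ι κ : Fin n → Fin N} {a : Fin N} {x₀ : C} →
                (∀ j → lookup w (ι j) ≡ lookup y j) →
                (∀ j → lookup w (κ j) ≡ lookup z j) → lookup w a ≡ x₀ →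
                M ⊨ insideF a ι κ [ w ] ⇔
                (∀ x → SameSide (B y) x₀ x → SameSide (B z) x₀ x)
    insideF-⊨ {w = w} y≗ z≗ a≡ = ∀-cong-⇔ λ x →
      →-cong-⇔ (sameSideF-⊨ {w = x ∷ w} y≗ a≡ refl) (sameSideF-⊨ {w = x ∷ w} z≗ a≡ refl)

    module _ (dim : IndependenceDimension≤1 M ψ) (chain : StrictChain) where

      open StrictChain chain

      private
        Side : Vec C n → Pred C c
        Side y = SameSide (B y) inner

        params : Vec C 2
        params = inner ∷ outer ∷ []

        -- The domain consists of all instances separating `inner` from `outer`. The chain itself
        -- need not be definable.
        domF : Formula L (n + 2)
        domF = Neg (sameSideF (n ↑ʳ zero) (n ↑ʳ suc zero) (_↑ˡ 2))

        leF eqF : Formula L (n + (n + 2))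
        leF = insideF (n ↑ʳ (n ↑ʳ zero)) (_↑ˡ (n + 2)) (λ j → n ↑ʳ (j ↑ˡ 2))
        eqF = And leF (insideF (n ↑ʳ (n ↑ʳ zero)) (λ j → n ↑ʳ (j ↑ˡ 2)) (_↑ˡ (n + 2)))

        domF-⊨ : ∀ y → definableSet M domF params y ⇔ (¬ Side y outer)
        domF-⊨ y = →-cong-⇔
          (sameSideF-⊨ (lookup-++ˡ y params)
             (lookup-++ʳ y params zero) (lookup-++ʳ y params (suc zero)))
          (mk⇔ lower ⊥-elim)

        module _ (y z : Vec C n) where
          w : Vec C (n + (n + 2))
          w = y ++ (z ++ params)

          y≗ : ∀ j → lookup w (j ↑ˡ (n + 2)) ≡ lookup y j
          y≗ = lookup-++ˡ y (z ++ params)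

          z≗ : ∀ j → lookup w (n ↑ʳ (j ↑ˡ 2)) ≡ lookup z j
          z≗ j = trans (lookup-++ʳ y (z ++ params) (j ↑ˡ 2)) (lookup-++ˡ z params j)

          inner≗ : lookup w (n ↑ʳ (n ↑ʳ zero)) ≡ inner
          inner≗ = trans (lookup-++ʳ y (z ++ params) (n ↑ʳ zero)) (lookup-++ʳ z params zero)

          leF-⊨ : definableRel M leF params y z ⇔ (∀ x → Side y x → Side z x)
          leF-⊨ = insideF-⊨ y≗ z≗ inner≗

          eqF-⊨ : definableRel M eqF params y z ⇔
                  ((∀ x → Side y x → Side z x) × (∀ x → Side z x → Side y x))
          eqF-⊨ = leF-⊨ ×-⇔ insideF-⊨ z≗ y≗ inner≗

        comparable : ∀ y z → ¬ Side y outer → ¬ Side z outer →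
                     (∀ x → Side y x → Side z x) ⊎ (∀ x → Side z x → Side y x)
        comparable y z y∌ z∌ =
          let s , ∈s = side (B y) em inner
              t , ∈t = side (B z) em inner
              y⇔ = λ {x} → sameSide⇔^ (B y) s ∈s {x}
              z⇔ = λ {x} → sameSide⇔^ (B z) t ∈t {x}
          in Sum.map
               (λ (y⊆z : (B y ^ s) ⊆ (B z ^ t)) x → from z⇔ ∘ y⊆z ∘ to y⇔)
               (λ (z⊆y : (B z ^ t) ⊆ (B y ^ s)) x → from y⇔ ∘ z⊆y ∘ to z⇔)
               (sides-comparable em (B y) (B z) (dim y z) s t ∈s ∈t
                   (y∌ ∘ from y⇔) (z∌ ∘ from z⇔))

        Side⇔ : ∀ k {x} → Side (instances k) x ⇔ (B (instances k) ^ sides k) x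
        Side⇔ k = sameSide⇔^ (B (instances k)) (sides k) (inner-∈ k)

        decreasing* : ∀ j k → (B (instances (j + k)) ^ sides (j + k)) ⊆
                              (B (instances k) ^ sides k)
        decreasing* zero    k x∈ = x∈
        decreasing* (suc j) k x∈ = decreasing* j k (decreasing (j + k) x∈)

        -- Otherwise side `j` would lie in side `k`, hence in side `suc j`, against strictness at
        -- `j`.
        not-inside : ∀ {j k} → j < k → ¬ (∀ x → Side (instances j) x → Side (instances k) x)
        not-inside {j} {k} j<k j⊆k =
          let i , k≡ = m≤n⇒∃[o]m+o≡n j<k
              x , x∈ , x∉ = strict j
          in x∉ (decreasing* i (suc j)
                  (subst (λ k → (B (instances k) ^ sides k) x)
                         (trans (sym k≡) (+-comm (suc j) i))
                         (to (Side⇔ k) (j⊆k x (from (Side⇔ j) x∈)))))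

      strictChain⇒linearOrder : InterpretsInfiniteLinearOrder M
      strictChain⇒linearOrder = record
        { params = params
        ; domF   = domF
        ; eqF    = eqF
        ; leF    = leF
        ; isTotalOrder = record
          { isPartialOrder = record
            { isPreorder = record
              { isEquivalence = record
                { refl  = λ {(y , _)} → from (eqF-⊨ y y) ((λ _ → id) , (λ _ → id))
                ; sym   = λ {(y , _)} {(z , _)} y≈z →
                    let y⊆z , z⊆y = to (eqF-⊨ y z) y≈z
                    in from (eqF-⊨ z y) (z⊆y , y⊆z)
                ; trans = λ {(y , _)} {(z , _)} {(u , _)} y≈z z≈u →
                    let y⊆z , z⊆y = to (eqF-⊨ y z) y≈z
                        z⊆u , u⊆z = to (eqF-⊨ z u) z≈u
                    in from (eqF-⊨ y u) ((λ x → z⊆u x ∘ y⊆z x) , (λ x → z⊆y x ∘ u⊆z x))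
                }
              ; reflexive = proj₁
              ; trans     = λ {(y , _)} {(z , _)} {(u , _)} y≤z z≤u →
                  from (leF-⊨ y u) λ x → to (leF-⊨ z u) z≤u x ∘ to (leF-⊨ y z) y≤z x
              }
            ; antisym = λ {(y , _)} {(z , _)} y≤z z≤y →
                from (eqF-⊨ y z) (to (leF-⊨ y z) y≤z , to (leF-⊨ z y) z≤y)
            }
          ; total = λ (y , y∈) (z , z∈) →
              [ inj₁ ∘ from (leF-⊨ y z) , inj₂ ∘ from (leF-⊨ z y) ]′
                (comparable y z (to (domF-⊨ y) y∈) (to (domF-⊨ z) z∈))
          }
        ; enum     = λ k → instances k , from (domF-⊨ (instances k)) (outer-∉ k ∘ to (Side⇔ k))
        ; infinite = λ {j} {k} j≈k →
            let j⊆k , k⊆j = to (eqF-⊨ (instances j) (instances k)) j≈k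
            in injective j⊆k k⊆j
        }
        where
        injective : ∀ {j k} → (∀ x → Side (instances j) x → Side (instances k) x) →
                    (∀ x → Side (instances k) x → Side (instances j) x) → j ≡ k
        injective {j} {k} j⊆k k⊆j with <-cmp j k
        ... | tri< j<k _ _ = ⊥-elim (not-inside j<k j⊆k)
        ... | tri≈ _ j≡k _ = j≡k
        ... | tri> _ _ k<j = ⊥-elim (not-inside k<j k⊆j)

  -- Boolean decompositions of formulas in one variable

  combine-def : (ε : BoolExpr n) {E : Env e} {B : Point E → Fin n → Pred C c} {a : Point E → C} →
                (∀ i → Definable E (λ v → B v i (a v))) →
                Definable E (λ v → combine ε (B v) (a v))
  combine-def (gen i)    D = D i
  combine-def empty      D = false-def λ _ ()
  combine-def (compl ε)  D = not-def (combine-def ε D)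
  combine-def (meet ε η) D = and-def (combine-def ε D) (combine-def η D)
  combine-def (join ε η) D = or-def (combine-def ε D) (combine-def η D)

  -- Schemes carry no parameters and form a type in `Set ℓ`, so saturation can quantify over all of
  -- them. The parameters of all generators make up one tuple, ready for a single existential
  -- quantifier.
  record Scheme : Set ℓ where
    field
      {count}   : ℕ
      arity     : Fin count → ℕ
      generator : ∀ i → Formula L (suc (arity i))
      shape     : BoolExpr count

    Dimension≤1 : Set c
    Dimension≤1 = ∀ i → IndependenceDimension≤1 M (generator i)

    generated : Vec C (totalLength arity) → Pred C c
    generated z = combine shape λ i → instanceSet M (generator i) (block z i)

  open Scheme

  module _ (φ : Formula L (suc n)) where

    DecomposedBy : Scheme → Pred (Vec C n) c
    DecomposedBy σ y = ∃[ z ] ∀ x → instanceSet M φ y x ⇔ generated σ z x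

    decomposedBy-def : ∀ σ → ParamDefinable (DecomposedBy σ)
    decomposedBy-def σ = ∃-def (∀₁-def
      (resp-def (λ _ → mk⇔ (λ φ⇔ → to φ⇔ , from φ⇔) (λ (f , g) → mk⇔ f g))
                (and-def (imp-def instance-def generated-def)
                         (imp-def generated-def instance-def))))
      where
      E : Env c
      E = 1 ▹ totalLength (arity σ) ▹ n ▹ base {0ℓ} ⊤

      first : IsCoord E (λ (a , _) → lookup a zero)
      first = inj₁ (zero , λ _ → refl)

      instance-def : Definable E (λ (a , z , y , _) → instanceSet M φ y (lookup a zero))
      instance-def = formula-def φ (λ (a , z , y , _) → lookup a zero ∷ y) λ where
        zero    → first
        (suc i) → inj₂ (_ , inj₂ (_ , inj₁ (i , λ _ → refl) , λ _ → refl) , λ _ → refl)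

      generated-def : Definable E (λ (a , z , y , _) → generated σ z (lookup a zero))
      generated-def = combine-def (shape σ) λ i →
        formula-def (generator σ i) (λ (a , z , y , _) → lookup a zero ∷ block z i) λ where
          zero    → first
          (suc j) → inj₂ (_ , inj₁ (blockIndex i j , λ _ → lookup∘tabulate _ j) ,
                          λ _ → refl)

    module _ (em : ∀ a → ExcludedMiddle a) where

      Decomposes : Vec C n → Scheme → Set c
      Decomposes y σ = Dimension≤1 σ × DecomposedBy σ y

      -- Compactness: if no finite list sufficed, saturation would give a `y` at which every scheme
      -- fails, against weak VC-minimality.
      finitelyManySchemes : Saturated M → WeaklyVCMinimal M →
                            ∃[ σs ] ∀ y → Any (Decomposes y) σs
      finitelyManySchemes saturated minimal =
        let σs , covers = cover in σs , λ y →
          Any.map (decidable-stable (em c))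
            (¬All⇒Any¬ (λ _ → em c) σs λ fails → covers (y , fails))
        where
        Fails : Scheme → Pred (Vec C n) c
        Fails σ y = ¬ Decomposes y σ

        fails-def : ∀ σ → ParamDefinable (Fails σ)
        -- The dimension bound does not depend on `y`, so only its truth value enters the formula.
        fails-def σ with em c {Dimension≤1 σ}
        ... | yes dim = not-def (and-def (true-def λ _ → dim) (decomposedBy-def σ))
        ... | no ¬dim = true-def λ _ → ¬dim ∘ proj₁

        decomposed : ∀ y → ∃[ σ ] Decomposes y σ
        decomposed y =
          let k , arity , ψ , cs , dim , ε , φ⊆ , ⊆φ = minimal φ y
          in record { arity = arity ; generator = ψ ; shape = ε } , dim , flatten cs , λ x →
               combine-cong ε (λ i → ≡⇒⇔ (cong (λ z → instanceSet M (ψ i) z x)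
                                                 (sym (block-flatten cs i))))
                 ⇔-∘ mk⇔ φ⊆ ⊆φ

        cover : ∃[ σs ] ¬ (∃[ y ] ListAll.All (λ σ → Fails σ y) σs)
        cover = decidable-stable (em (ℓ ⊔ c)) λ none →
          let y , fails = saturatedTuple saturated n fails-def
                            (λ σs → decidable-stable (em (ℓ ⊔ c)) λ no → none (σs , no))
              σ , dec   = decomposed y
          in fails σ dec

      module _ (finiteRank : ∀ {k} (ψ : Formula L (suc k)) → IndependenceDimension≤1 M ψ →
                             ∃[ h ] ¬ Rank≥ (relation 1 ψ) h (λ _ → ⊤)) where

        generated-types : ∀ σ → Dimension≤1 σ →
                          (z : List Bool → Vec C (totalLength (arity σ))) →
                          CountablyManyTypes (λ x s → generated σ (z s) x)
        generated-types σ dim z = types-combine (shape σ) λ i →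
          types-pull (λ x → x ∷ [] , []) (λ _ _ → ⇔-id _)
            (types-countable-fibre {m = 0} em (generator σ i)
               (finiteRank (generator σ i) (dim i))
               {λ (_ , s) → block (z s) i} (λ _ → inj₂ (_ , _ , λ _ → refl))
               types-countable₀)

        -- Indices decomposed by the first scheme use it, and the others are left to the rest of the
        -- list. This case distinction does not depend on `x`, so it adds no types.
        covered-types : ∀ σs (y : List Bool → Vec C n) →
                        Σ[ R ∈ (C → List Bool → Set c) ]
                        CountablyManyTypes R ×
                        (∀ s → Any (Decomposes (y s)) σs → ∀ x →
                         instanceSet M φ (y s) x ⇔ R x s)
        covered-types []       y = (λ _ _ → ⊤) , types-const , λ _ ()
        covered-types (σ ∷ σs) y with em c {Dimension≤1 σ} | covered-types σs y
        ... | no ¬dim | R , R-types , φ⇔R = R , R-types , λ where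
          s (here (dim , _)) → ⊥-elim (¬dim dim)
          s (there later)    → φ⇔R s later
        ... | yes dim | R , R-types , φ⇔R =
          (λ x s → (D s × generated σ (z s) x) ⊎ (¬ D s × R x s)) ,
          types-or (types-and types-const (generated-types σ dim z))
                   (types-and types-const R-types) ,
          correct
          where
          D : List Bool → Set c
          D s = DecomposedBy σ (y s)

          parameters : ∀ {s} → Dec (D s) → Vec C (totalLength (arity σ))
          parameters (yes (z , _)) = z
          -- An arbitrary value: at such an index the disjunct for `σ` is false.
          parameters (no _)        = replicate _ default

          z : List Bool → Vec C (totalLength (arity σ))
          z s = parameters (em c {D s})

          correct : ∀ s → Any (Decomposes (y s)) (σ ∷ σs) → ∀ x →
                    instanceSet M φ (y s) x ⇔ ((D s × generated σ (z s) x) ⊎ (¬ D s × R x s))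
          correct s decomposes x with em c {D s}
          ... | yes d@(_ , φ⇔) = mk⇔ (λ φx → inj₁ (d , to (φ⇔ x) φx))
                  [ (λ (_ , gx) → from (φ⇔ x) gx) , (λ (¬d , _) → ⊥-elim (¬d d)) ]′
          ... | no ¬d = mk⇔ (λ φx → inj₂ (¬d , to (φ⇔R s (later decomposes) x) φx))
                  [ (λ (d , _) → ⊥-elim (¬d d))
                  , (λ (_ , Rx) → from (φ⇔R s (later decomposes) x) Rx) ]′
            where
            later : Any (Decomposes (y s)) (σ ∷ σs) → Any (Decomposes (y s)) σs
            later (here (_ , d)) = ⊥-elim (¬d d)
            later (there l)      = l

        instance-types : Saturated M → WeaklyVCMinimal M → (y : List Bool → Vec C n) →
                         CountablyManyTypes (λ x s → relation 1 φ x (y s))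
        instance-types saturated minimal y =
          let σs , covers       = finitelyManySchemes saturated minimal
              R , R-types , φ⇔R = covered-types σs y
          in types-pull head (λ { (x ∷ []) s → φ⇔R s (covers (y s)) x }) R-types

  -- Induction on the number of variables, and stability

  module _ (em : ∀ a → ExcludedMiddle a) (saturated : Saturated M) (minimal : WeaklyVCMinimal M)
           (noOrder : ¬ InterpretsInfiniteLinearOrder M) where

    dimension≤1⇒finiteRank : (ψ : Formula L (suc n)) → IndependenceDimension≤1 M ψ →
                             ∃[ h ] ¬ Rank≥ (relation 1 ψ) h (λ _ → ⊤)
    dimension≤1⇒finiteRank ψ dim = ¬∀⇒∃¬ em λ infinite →
      noOrder (strictChain⇒linearOrder em ψ dim (strictChain em ψ saturated dim infinite))

    finiteRank₁ : (φ : Formula L (suc n)) → ∃[ h ] ¬ Rank≥ (relation 1 φ) h (λ _ → ⊤)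
    finiteRank₁ φ = ¬∀⇒∃¬ em λ infinite →
      Tree.uncountablyManyTypes 1 φ saturated infinite em
        -- The omitted parameters are the labels of the tree.
        (instance-types φ em dimension≤1⇒finiteRank saturated minimal _)

    -- The head variable is split off and the tail joins the parameters, so only formulas in one
    -- variable need finite rank.
    types-countable : ∀ m → TypesCountable m
    types-countable zero = types-countable₀
    types-countable (suc m) D =
      types-pull (λ xs → head xs ∷ [] , tail xs)
                 (λ { (x ∷ xs) s → defines′ F x (xs , s) })
                 (types-countable-fibre em (formula′ F) (finiteRank₁ (formula′ F))
                    {args′ F} (isTuple′ F) (types-countable m))
      where F = firstVar (pull-def D ∷-map)

    stable : Stable M
    stable m n φ (a , b , φ⇔<) =
      Tree.uncountablyManyTypes m φ saturated
        (λ h → ladder⇒Rank≥ (relation m φ) a b φ⇔< h 0 λ _ _ _ → tt) em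
        -- Over `base` every function of the node is an admissible tuple, in particular the
        -- labelling.
        (types-countable m (relation-def m φ {E = base (List Bool)} _))

theorem3p5 : (∀ a → ExcludedMiddle a) →
    ∀ {ℓ c} {L : Language ℓ} (T : Theory L) → Complete T →
    (𝔠 : Structure L c) → IsMonsterModel T 𝔠 →
    WeaklyVCMinimal 𝔠 →
    Stable 𝔠 ⊎ InterpretsInfiniteLinearOrder 𝔠
theorem3p5 em {ℓ} {c} T _ 𝔠 monster minimal with em (ℓ ⊔ c) {InterpretsInfiniteLinearOrder 𝔠}
... | yes order   = inj₂ order
... | no  noOrder = inj₁ (stable 𝔠 em (IsMonsterModel.saturated monster) minimal noOrder)
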